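{- Let $G=(V,E)$ be a finite simple graph and let $\ell$ be a positive integer. Let $\mathcal{T}_G$ be the search tree of the pivoting maximal clique enumeration algorithm (described in the context) executed on $G$, and let $r$ be a node of $\mathcal{T}_G$ with associated triple $(C,P,X)$, so that $C$ is its candidate set and $P$ its perspective set. Let $\overline{\omega}(G[P])$ be any upper bound on the clique number $\omega(G[P])$, i.e. any number with $\omega(G[P])\le\overline{\omega}(G[P])$. If $$\delta_e(C,P) + |C|\,|P| - \ell\,|C| \;\geq\; \overline{\omega}(G[P])\cdot(\ell + |C|),$$ then the subtree of $\mathcal{T}_G$ rooted at $r$ contains no leaf corresponding to an $\ell$-isolated maximal clique of $G$.
   Context: Notation. All graphs are finite and simple. For a graph $G=(V,E)$ and $v\in V$, $N(v)$ is the set of neighbors of $v$. For $I\subseteq V$, $G[I]$ is the subgraph induced by $I$; $\omega(G[I])$ is its clique number (size of a largest clique). The external degree $\delta_e(I)$ is the number of edges with one endpoint in $I$ and the other in $V\setminus I$. For disjoint $I,L\subseteq V$, $\delta_e(I,L)$ (external degree of $I$ neglecting $L$) is the number of edges with one endpoint in $I$ and the other in $V\setminus(I\cup L)$. $\ell$-isolation. For an integer $\ell>0$, a set $I\subseteq V$ is $\ell$-isolated in $G$ if $\delta_e(I)<\ell\cdot|I|$. A clique is maximal if it is not contained in any larger clique; an $\ell$-isolated maximal clique is a maximal clique of $G$ whose vertex set is $\ell$-isolated. Algorithm (Bron–Kerbosch with pivoting of Tomita, Tanaka and Takahashi). The recursive procedure $\mathrm{ProcMCE}(C,P,X)$, initially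 called as $\mathrm{ProcMCE}(\varnothing,V,\varnothing)$, works as follows. If $P=\varnothing$ and $X=\varnothing$, output $C$ and return. Otherwise choose a pivot $v_p\in P\cup X$ maximizing $|N(v_p)\cap P|$ (ties broken arbitrarily). For each $v$ in the set $P\setminus N(v_p)$ (in arbitrary order), call $\mathrm{ProcMCE}(C\cup\{v\},\,P\cap N(v),\,X\cap N(v))$, with the current values of $P$ and $X$, and after the call returns set $P\leftarrow P\setminus\{v\}$ and $X\leftarrow X\cup\{v\}$. Search tree. The search tree $\mathcal{T}_G$ has one node for each call of $\mathrm{ProcMCE}$, associated with the triple $(C,P,X)$ of arguments of that call; the children of a node are the recursive calls it makes directly. $C$ is the candidate set and $P$ the perspective set of the node. A leaf corresponds to a maximal clique if its triple has the form $(C',\varnothing,\varnothing)$, in which case the clique it corresponds to is $C'$. -}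

module Defs where

open import Data.Fin.Base using (Fin)
open import Data.Fin.Properties using (all?) renaming (_≟_ to _≟ᶠ_)
open import Data.Fin.Subset
open import Data.Fin.Subset.Properties using (_∈?_; _⊆?_; x∈p∩q⁺)
open import Data.List.Base using (List; []; _∷_; _++_; map; filter; length; allFin; cartesianProduct)
open import Data.List.Extrema.Nat using (max)
open import Data.Nat.Base using (ℕ; zero; suc; _*_; _≤_; _<_)
open import Data.Product.Base using (_×_; _,_)
open import Data.Vec.Base as Vec using (tabulate)
open import Level using (0ℓ)
open import Relation.Binary.Core using (Rel)
open import Relation.Binary.Definitions using (Decidable; Symmetric; Irreflexive)
open import Relation.Binary.PropositionalEquality.Core using (_≡_; _≢_)
open import Relation.Nullary.Decidable using (Dec; does; _×-dec_; _→-dec_; ¬?)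
open import Relation.Nullary.Negation.Core using (¬_)

private
  variable
    n : ℕ

-- The vertex set is an arbitrary subset of Fin n, so that an induced
-- subgraph is again a graph on a subset of the same Fin n.
record Graph (n : ℕ) : Set₁ where
  field
    V      : Subset n
    Adj    : Rel (Fin n) 0ℓ
    Adj?   : Decidable Adj
    sym    : Symmetric Adj
    irrefl : Irreflexive _≡_ Adj
    Adj⇒∈V : ∀ {u v} → Adj u v → u ∈ V

  N : Fin n → Subset n
  N v = tabulate λ u → does (Adj? v u)

open Graph public using (V; N)

induced : Graph n → Subset n → Graph n
induced G I = record
  { V      = V G ∩ I
  ; Adj    = λ u v → Adj u v × u ∈ I × v ∈ I
  ; Adj?   = λ u v → Adj? u v ×-dec (u ∈? I) ×-dec (v ∈? I)
  ; sym    = λ (uv , u∈I , v∈I) → sym uv , v∈I , u∈I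
  ; irrefl = λ u≡v (uv , _) → irrefl u≡v uv
  ; Adj⇒∈V = λ (uv , u∈I , _) → x∈p∩q⁺ (Adj⇒∈V uv , u∈I)
  }
  where open Graph G using (Adj; Adj?; sym; irrefl; Adj⇒∈V)

module _ (G : Graph n) where
  open Graph G using (Adj; Adj?)

  IsClique : Subset n → Set
  IsClique K = K ⊆ V G × (∀ u v → u ∈ K → v ∈ K → u ≢ v → Adj u v)

  isClique? : (K : Subset n) → Dec (IsClique K)
  isClique? K = (K ⊆? V G) ×-dec all? λ u → all? λ v →
    (u ∈? K) →-dec (v ∈? K) →-dec ¬? (u ≟ᶠ v) →-dec Adj? u v

  IsMaximalClique : Subset n → Set
  IsMaximalClique K = IsClique K × (∀ K′ → IsClique K′ → ¬ (K ⊂ K′))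

  -- Each edge is counted once per orientation from A to B, hence exactly
  -- once when A and B are disjoint, as they are in both uses below.
  edgesBetween : Subset n → Subset n → ℕ
  edgesBetween A B = length (filter
    (λ (u , v) → (u ∈? A) ×-dec (v ∈? B) ×-dec Adj? u v)
    (cartesianProduct (allFin n) (allFin n)))

  δₑ : Subset n → ℕ
  δₑ I = edgesBetween I (V G ─ I)

  δₑ-neglecting : Subset n → Subset n → ℕ
  δₑ-neglecting I L = edgesBetween I (V G ─ (I ∪ L))

  Isolated : ℕ → Subset n → Set
  Isolated ℓ I = δₑ I < ℓ * ∣ I ∣

allSubsets : ∀ n → List (Subset n)
allSubsets zero    = Vec.[] ∷ []
allSubsets (suc n) = map (outside Vec.∷_) (allSubsets n) ++ map (inside Vec.∷_) (allSubsets n)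

-- The default value 0 is harmless: the empty set is a clique.
ω : Graph n → ℕ
ω {n} G = max 0 (map ∣_∣ (filter (isClique? G) (allSubsets n)))

module _ (G : Graph n) where

  IsPivot : (P X : Subset n) → Fin n → Set
  IsPivot P X vₚ = vₚ ∈ P ∪ X ×
    (∀ u → u ∈ P ∪ X → ∣ N G u ∩ P ∣ ≤ ∣ N G vₚ ∩ P ∣)

  -- ProcMCE C P X is the type of recursion trees of possible executions of
  -- the call with arguments (C, P, X): the choices of pivots and of loop
  -- orders are recorded in the tree.  Loop C P X S is the part of the loop
  -- that remains when P and X have their current values and the vertices
  -- in S have not yet been visited.
  data ProcMCE : (C P X : Subset n) → Set
  data Loop (C : Subset n) : (P X S : Subset n) → Set

  data ProcMCE where
    output : ∀ C → ProcMCE C ⊥ ⊥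
    -- A pivot exists only if P or X is nonempty.
    branch : ∀ {C P X} vₚ → IsPivot P X vₚ →
             Loop C P X (P ─ N G vₚ) → ProcMCE C P X

  data Loop C where
    done : ∀ {P X} → Loop C P X ⊥
    step : ∀ {P X S} v → v ∈ S →
           ProcMCE (C ∪ ⁅ v ⁆) (P ∩ N G v) (X ∩ N G v) →
           Loop C (P - v) (X ∪ ⁅ v ⁆) (S - v) →
           Loop C P X S

  SearchTree : Set
  SearchTree = ProcMCE ⊥ (V G) ⊥

module _ {G : Graph n} {C P X : Subset n} where

  -- s NodeOf t: the tree s is the subtree of t rooted at some node of t.
  data _NodeOf_ (s : ProcMCE G C P X) :
    ∀ {C′ P′ X′} → ProcMCE G C′ P′ X′ → Set
  data _NodeOfLoop_ (s : ProcMCE G C P X) {C′} :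
    ∀ {P′ X′ S} → Loop G C′ P′ X′ S → Set

  data _NodeOf_ s where
    root  : s NodeOf s
    below : ∀ {C′ P′ X′ vₚ} {pivot : IsPivot G P′ X′ vₚ}
            {l : Loop G C′ P′ X′ (P′ ─ N G vₚ)} →
            s NodeOfLoop l → s NodeOf branch vₚ pivot l

  data _NodeOfLoop_ s {C′} where
    here  : ∀ {P′ X′ S v} {v∈S : v ∈ S}
            {t : ProcMCE G (C′ ∪ ⁅ v ⁆) (P′ ∩ N G v) (X′ ∩ N G v)}
            {l : Loop G C′ (P′ - v) (X′ ∪ ⁅ v ⁆) (S - v)} →
            s NodeOf t → s NodeOfLoop step v v∈S t l
    there : ∀ {P′ X′ S v} {v∈S : v ∈ S}
            {t : ProcMCE G (C′ ∪ ⁅ v ⁆) (P′ ∩ N G v) (X′ ∩ N G v)}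
            {l : Loop G C′ (P′ - v) (X′ ∪ ⁅ v ⁆) (S - v)} →
            s NodeOfLoop l → s NodeOfLoop step v v∈S t l

{-# OPTIONS --safe #-}

-- Let K be an output leaf below the node (C, P, X) and put D = K ∩ P.
-- Then C ⊆ K ⊆ C ∪ P and C is completely joined to P, so the edges leaving C
-- for V ∖ (C ∪ P) and the |C| (|P| − |D|) edges from C to P ∖ K all leave K.
-- If K is ℓ-isolated, this gives
--   δₑ(C, P) + |C| (|P| − |D|) ≤ δₑ(K) < ℓ |K| ≤ ℓ (|C| + |D|),
-- that is δₑ(C, P) + |C| |P| − ℓ |C| < |D| (ℓ + |C|).  But D is a clique of
-- G[P], so |D| ≤ ω(G[P]).
module Submission where

open import Defs
open import Data.Fin.Base using (Fin; zero; suc)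
open import Data.Fin.Subset
  using (Subset; inside; outside; ∣_∣; _∈_; _∉_; _⊆_; _∩_; _∪_; _─_; ⁅_⁆)
  renaming (_-_ to _∖_)
open import Data.Fin.Subset.Properties
  using (_∈?_; drop-there; ∉⊥; p⊆q⇒∣p∣≤∣q∣; p∩q⊆p; x∈p∩q⁺; x∈p∩q⁻; p⊆p∪q; q⊆p∪q; x∈p∪q⁻;
         p─q⊆p; x∈p∧x∉q⇒x∈p─q; x∈⁅y⁆⇒x≡y)
open import Data.Integer.Base as ℤ using (+_; _-_)
import Data.Integer.Properties as ℤ
open import Data.List.Base
  using (List; []; _∷_; _++_; map; filter; length; tabulate; allFin; cartesianProduct)
open import Data.List.Extrema.Nat using (xs≤max)
import Data.List.Membership.Propositional as List
open import Data.List.Membership.Propositional.Properties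
  using (∈-++⁺ˡ; ∈-++⁺ʳ; ∈-filter⁺; ∈-map⁺)
open import Data.List.Properties using (length-++; filter-++; filter-≐)
open import Data.List.Relation.Unary.All using (lookup)
open import Data.List.Relation.Unary.Any using (here)
open import Data.Nat.Base using (ℕ; suc; NonZero; _+_; _*_; _≤_; _<_; z≤n; s≤s)
open import Data.Nat.Properties
open import Data.Nat.Tactic.RingSolver using (solve-∀)
open import Data.Product.Base using (∃; _×_; _,_; proj₂)
open import Data.Rational.Base as ℚ using (ℚ)
open import Data.Rational.Literals using (fromℤ)
import Data.Rational.Properties as ℚ
import Data.Rational.Unnormalised.Properties as ℚᵘ
open import Data.Sum.Base using ([_,_])
open import Data.Vec.Base as Vec using ([]; _∷_)
open import Data.Vec.Properties using ([]=⇒lookup; lookup∘tabulate)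
open import Function.Base using (_∘_; id)
open import Level using (Level)
open import Relation.Binary.PropositionalEquality
  using (_≡_; refl; sym; trans; cong; cong₂; subst; subst₂; module ≡-Reasoning)
open import Relation.Nullary.Decidable using (yes; no; _×-dec_)
open import Relation.Nullary.Negation.Core using (¬_; contradiction)
open import Relation.Unary using (Pred; Decidable; _≐_) renaming (_⊆_ to _⊆ᵖ_; _⊥_ to Disjoint)

private
  variable
    n : ℕ
    a b ℓ₁ ℓ₂ ℓ₃ : Level
    A : Set a
    B : Set b
    x y : Fin n

-- Differences and cardinalities of finite subsets

x∈p─q⇒x∉q : (p q : Subset n) → x ∈ p ─ q → x ∉ q
x∈p─q⇒x∉q (_ ∷ _) (inside  ∷ _) () Vec.here
x∈p─q⇒x∉q (_ ∷ p) (inside  ∷ q) (Vec.there x∈) (Vec.there x∈q) = x∈p─q⇒x∉q p q x∈ x∈q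
x∈p─q⇒x∉q (_ ∷ p) (outside ∷ q) (Vec.there x∈) (Vec.there x∈q) = x∈p─q⇒x∉q p q x∈ x∈q

─-monoˡ-⊆ : {p q : Subset n} (r : Subset n) → p ⊆ q → p ─ r ⊆ q ─ r
─-monoˡ-⊆ {p = p} r p⊆q x∈p─r =
  x∈p∧x∉q⇒x∈p─q (p⊆q (p─q⊆p p r x∈p─r)) (x∈p─q⇒x∉q p r x∈p─r)

∣p∪q∣≤∣p∣+∣q∣ : (p q : Subset n) → ∣ p ∪ q ∣ ≤ ∣ p ∣ + ∣ q ∣
∣p∪q∣≤∣p∣+∣q∣ []            []            = z≤n
∣p∪q∣≤∣p∣+∣q∣ (outside ∷ p) (outside ∷ q) = ∣p∪q∣≤∣p∣+∣q∣ p q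
∣p∪q∣≤∣p∣+∣q∣ (outside ∷ p) (inside  ∷ q) =
  subst (suc ∣ p ∪ q ∣ ≤_) (sym (+-suc ∣ p ∣ ∣ q ∣)) (s≤s (∣p∪q∣≤∣p∣+∣q∣ p q))
∣p∪q∣≤∣p∣+∣q∣ (inside  ∷ p) (outside ∷ q) = s≤s (∣p∪q∣≤∣p∣+∣q∣ p q)
∣p∪q∣≤∣p∣+∣q∣ (inside  ∷ p) (inside  ∷ q) =
  s≤s (≤-trans (∣p∪q∣≤∣p∣+∣q∣ p q) (+-monoʳ-≤ ∣ p ∣ (n≤1+n ∣ q ∣)))

-- With `p` = P and `q` = K the intersection is literally D = `K ∩ P`, which is why `q` stands first
-- in it.
∣p∣≤∣p─q∣+∣q∩p∣ : (p q : Subset n) → ∣ p ∣ ≤ ∣ p ─ q ∣ + ∣ q ∩ p ∣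
∣p∣≤∣p─q∣+∣q∩p∣ p q = ≤-trans (p⊆q⇒∣p∣≤∣q∣ split) (∣p∪q∣≤∣p∣+∣q∣ (p ─ q) (q ∩ p))
  where
  split : p ⊆ (p ─ q) ∪ (q ∩ p)
  split {x} x∈p with x ∈? q
  ... | yes x∈q = q⊆p∪q (p ─ q) (q ∩ p) (x∈p∩q⁺ (x∈q , x∈p))
  ... | no  x∉q = p⊆p∪q (q ∩ p) (x∈p∧x∉q⇒x∈p─q x∈p x∉q)

-- Counting with filtered lists

-- An entry passes at most one of the filters on the left, and then it also passes the filter on the
-- right.
length-filter-disjoint : {P : Pred A ℓ₁} {Q : Pred A ℓ₂} {R : Pred A ℓ₃}
  (P? : Decidable P) (Q? : Decidable Q) (R? : Decidable R) →
  P ⊆ᵖ R → Q ⊆ᵖ R → Disjoint P Q → (xs : List A) →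
  length (filter P? xs) + length (filter Q? xs) ≤ length (filter R? xs)
length-filter-disjoint P? Q? R? P⊆R Q⊆R P⊥Q [] = z≤n
length-filter-disjoint P? Q? R? P⊆R Q⊆R P⊥Q (x ∷ xs)
  with ih ← length-filter-disjoint P? Q? R? P⊆R Q⊆R P⊥Q xs | P? x | Q? x | R? x
... | yes Px | yes Qx | _      = contradiction (Px , Qx) P⊥Q
... | yes Px | no  _  | yes _  = s≤s ih
... | yes Px | _      | no ¬Rx = contradiction (P⊆R Px) ¬Rx
... | no  _  | yes Qx | yes _  = ≤-trans (≤-reflexive (+-suc _ _)) (s≤s ih)
... | no  _  | yes Qx | no ¬Rx = contradiction (Q⊆R Qx) ¬Rx
... | no  _  | no  _  | yes _  = m≤n⇒m≤1+n ih
... | no  _  | no  _  | no  _  = ih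

module _ {P : Pred A ℓ₁} {Q : Pred B ℓ₂} (P? : Decidable P) (Q? : Decidable Q) where

  private
    P×Q? : Decidable (λ ((x , y) : A × B) → P x × Q y)
    P×Q? (x , y) = P? x ×-dec Q? y

  length-filter-map-, : ∀ {x} (ys : List B) → P x →
    length (filter P×Q? (map (x ,_) ys)) ≡ length (filter Q? ys)
  length-filter-map-, []       Px = refl
  length-filter-map-, {x} (y ∷ ys) Px with ih ← length-filter-map-, ys Px | P? x | Q? y
  ... | yes _  | yes _ = cong suc ih
  ... | yes _  | no  _ = ih
  ... | no ¬Px | _     = contradiction Px ¬Px

  length-filter-map-,-∁ : ∀ {x} (ys : List B) → ¬ P x →
    length (filter P×Q? (map (x ,_) ys)) ≡ 0
  length-filter-map-,-∁ []       ¬Px = refl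
  length-filter-map-,-∁ {x} (y ∷ ys) ¬Px with ih ← length-filter-map-,-∁ ys ¬Px | P? x
  ... | yes Px = contradiction Px ¬Px
  ... | no  _  = ih

  -- Counting row by row: the row of `x` contributes the full count for `Q` when `P x` holds, and 0
  -- otherwise.
  length-filter-cartesianProduct : ∀ xs ys →
    length (filter P×Q? (cartesianProduct xs ys)) ≡ length (filter P? xs) * length (filter Q? ys)
  length-filter-cartesianProduct []       ys = refl
  length-filter-cartesianProduct (x ∷ xs) ys = begin
    length (filter P×Q? (map (x ,_) ys ++ cartesianProduct xs ys))
      ≡⟨ cong length (filter-++ P×Q? (map (x ,_) ys) (cartesianProduct xs ys)) ⟩
    length (filter P×Q? (map (x ,_) ys) ++ filter P×Q? (cartesianProduct xs ys))
      ≡⟨ length-++ (filter P×Q? (map (x ,_) ys)) ⟩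
    length (filter P×Q? (map (x ,_) ys)) + length (filter P×Q? (cartesianProduct xs ys))
      ≡⟨ cong₂ _+_ refl (length-filter-cartesianProduct xs ys) ⟩
    length (filter P×Q? (map (x ,_) ys)) + length (filter P? xs) * length (filter Q? ys)
      ≡⟨ row ⟩
    length (filter P? (x ∷ xs)) * length (filter Q? ys) ∎
    where
    open ≡-Reasoning

    row : length (filter P×Q? (map (x ,_) ys)) + length (filter P? xs) * length (filter Q? ys) ≡
          length (filter P? (x ∷ xs)) * length (filter Q? ys)
    row with P? x
    ... | yes Px = cong (_+ _) (length-filter-map-, ys Px)
    ... | no ¬Px = cong (_+ _) (length-filter-map-,-∁ ys ¬Px)

-- A general `f` in place of `id` makes the induction go through, since the tail of `tabulate f` is
-- `tabulate (f ∘ suc)`.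
length-filter-tabulate : {P : Pred A ℓ₁} (P? : Decidable P) (f : Fin n → A) (p : Subset n) →
  (_∈ p) ≐ (P ∘ f) → length (filter P? (tabulate f)) ≡ ∣ p ∣
length-filter-tabulate P? f [] _ = refl
length-filter-tabulate P? f (s ∷ p) (p⊆P , P⊆p)
  with ih ← length-filter-tabulate P? (f ∘ suc) p
              ((λ x∈p → p⊆P (Vec.there x∈p)) , drop-there ∘ P⊆p)
     | P? (f zero) | s
... | yes _  | inside  = cong suc ih
... | yes P₀ | outside = contradiction (P⊆p P₀) λ ()
... | no ¬P₀ | inside  = contradiction (p⊆P Vec.here) ¬P₀
... | no _   | outside = ih

length-filter-∈ : (p : Subset n) → length (filter (_∈? p) (allFin n)) ≡ ∣ p ∣
length-filter-∈ p = length-filter-tabulate (_∈? p) id p (id , id)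

-- Ensures that the maximum defining `ω` ranges over every clique.
∈-allSubsets : (p : Subset n) → p List.∈ allSubsets n
∈-allSubsets []            = here refl
∈-allSubsets (outside ∷ p) = ∈-++⁺ˡ (∈-map⁺ (outside ∷_) (∈-allSubsets p))
∈-allSubsets (inside  ∷ p) = ∈-++⁺ʳ _ (∈-map⁺ (inside ∷_) (∈-allSubsets p))

-- From the rational hypothesis to natural numbers

fromℤ-cancel-≤ : ∀ {i j} → fromℤ i ℚ.≤ fromℤ j → i ℤ.≤ j
fromℤ-cancel-≤ {i} {j} i≤j =
  -- Rationals are compared by cross-multiplication; both denominators are 1.
  subst₂ ℤ._≤_ (ℤ.*-identityʳ i) (ℤ.*-identityʳ j) (ℚ.drop-*≤* i≤j)

-- Multiplication in `ℚ` normalises by a gcd that is stuck on variables; for unnormalised rationals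
-- the two sides agree by computation.
fromℤ-homo-* : ∀ i j → fromℤ (i ℤ.* j) ≡ fromℤ i ℚ.* fromℤ j
fromℤ-homo-* i j = ℚ.toℚᵘ-injective (ℚᵘ.≃-sym (ℚ.toℚᵘ-homo-* (fromℤ i) (fromℤ j)))

-- Since s ≥ 0, the chain w s ≤ ω̄ s ≤ m - k removes the rational ω̄. Moving k to the left avoids a
-- difference that may be negative.
≤-eliminate-bound : ∀ {w s m k : ℕ} (ω̄ : ℚ) → fromℤ (+ w) ℚ.≤ ω̄ →
  ω̄ ℚ.* fromℤ (+ s) ℚ.≤ fromℤ (+ m - + k) → w * s + k ≤ m
≤-eliminate-bound {w} {s} {m} {k} ω̄ w≤ω̄ ω̄s≤m-k = ℤ.drop‿+≤+ (begin
  + (w * s) ℤ.+ + k         ≡⟨ cong (ℤ._+ + k) (ℤ.pos-* w s) ⟩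
  + w ℤ.* + s ℤ.+ + k       ≤⟨ ℤ.+-monoˡ-≤ (+ k) (fromℤ-cancel-≤ ws≤m-k) ⟩
  + m - + k ℤ.+ + k         ≡⟨ ℤ.+-assoc (+ m) (ℤ.- + k) (+ k) ⟩
  + m ℤ.+ (ℤ.- + k ℤ.+ + k) ≡⟨ cong (λ i → + m ℤ.+ i) (ℤ.+-inverseˡ (+ k)) ⟩
  + m ℤ.+ + 0               ≡⟨ ℤ.+-identityʳ (+ m) ⟩
  + m                       ∎)
  where
  open ℤ.≤-Reasoning

  ws≤m-k : fromℤ (+ w ℤ.* + s) ℚ.≤ fromℤ (+ m - + k)
  ws≤m-k = subst (ℚ._≤ fromℤ (+ m - + k)) (sym (fromℤ-homo-* (+ w) (+ s)))
    (ℚ.≤-trans (ℚ.*-monoʳ-≤-nonNeg (fromℤ (+ s)) w≤ω̄) ω̄s≤m-k)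

-- Cliques and edge counts

module _ (G : Graph n) where
  open Graph G using (Adj; Adj?; irrefl; Adj⇒∈V) renaming (sym to Adj-sym)

  ∈N⇒Adj : x ∈ N G y → Adj y x
  -- If `Adj? y x` answered `no`, the equation matched alongside it would read `false ≡ true`; so
  -- only the `yes` case remains.
  ∈N⇒Adj {x} {y} x∈N with Adj? y x | trans (sym (lookup∘tabulate _ x)) ([]=⇒lookup x∈N)
  ... | yes yx | _ = yx

  clique⇒∣∣≤ω : ∀ {K} → IsClique G K → ∣ K ∣ ≤ ω G
  clique⇒∣∣≤ω {K} clique = lookup (xs≤max 0 _)
    (∈-map⁺ ∣_∣ (∈-filter⁺ (isClique? G) (∈-allSubsets K) clique))

  induced-clique : ∀ {K} I → IsClique G K → IsClique (induced G I) (K ∩ I)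
  induced-clique {K} I (K⊆V , K-adj) =
    (λ x∈K∩I → let x∈K , x∈I = x∈p∩q⁻ K I x∈K∩I in x∈p∩q⁺ (K⊆V x∈K , x∈I)) ,
    λ u v u∈ v∈ u≢v →
      let u∈K , u∈I = x∈p∩q⁻ K I u∈
          v∈K , v∈I = x∈p∩q⁻ K I v∈
      in K-adj u v u∈K v∈K u≢v , u∈I , v∈I

  Joined : Subset n → Subset n → Set
  Joined C P = ∀ {u v} → u ∈ C → v ∈ P → Adj u v

  -- Adjacency is automatic here, so its test drops out of the filter and the count becomes that of
  -- a product set.
  edgesBetween-joined : ∀ {C P} → Joined C P → edgesBetween G C P ≡ ∣ C ∣ * ∣ P ∣
  edgesBetween-joined {C} {P} joined = begin
    edgesBetween G C P
      ≡⟨ cong length (filter-≐ _ C×P? ((λ (u∈C , v∈P , _) → u∈C , v∈P) ,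
           (λ (u∈C , v∈P) → u∈C , v∈P , joined u∈C v∈P)) (cartesianProduct (allFin n) (allFin n))) ⟩
    length (filter C×P? (cartesianProduct (allFin n) (allFin n)))
      ≡⟨ length-filter-cartesianProduct (_∈? C) (_∈? P) (allFin n) (allFin n) ⟩
    length (filter (_∈? C) (allFin n)) * length (filter (_∈? P) (allFin n))
      ≡⟨ cong₂ _*_ (length-filter-∈ C) (length-filter-∈ P) ⟩
    ∣ C ∣ * ∣ P ∣ ∎
    where
    open ≡-Reasoning

    C×P? : Decidable (λ ((u , v) : Fin n × Fin n) → u ∈ C × v ∈ P)
    C×P? (u , v) = (u ∈? C) ×-dec (v ∈? P)

  edgesBetween-disjoint : ∀ {A B B₁ B₂ C} → A ⊆ C → B₁ ⊆ B → B₂ ⊆ B → (∀ {x} → x ∈ B₁ → x ∉ B₂) →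
    edgesBetween G A B₁ + edgesBetween G A B₂ ≤ edgesBetween G C B
  edgesBetween-disjoint A⊆C B₁⊆B B₂⊆B disjoint = length-filter-disjoint _ _ _
    (λ (u∈A , v∈B₁ , uv) → A⊆C u∈A , B₁⊆B v∈B₁ , uv)
    (λ (u∈A , v∈B₂ , uv) → A⊆C u∈A , B₂⊆B v∈B₂ , uv)
    (λ ((_ , v∈B₁ , _) , (_ , v∈B₂ , _)) → disjoint v∈B₁ v∈B₂)
    (cartesianProduct (allFin n) (allFin n))

  -- Both terms on the left count edges from C to the outside of K. Their target sets, V minus
  -- `C ∪ P` and `P ─ K`, are disjoint; the first avoids K because `K ⊆ C ∪ P`.
  δₑ-lower-bound : ∀ {C P K} → Joined C P → P ⊆ V G → C ⊆ K → K ⊆ C ∪ P →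
    δₑ-neglecting G C P + ∣ C ∣ * ∣ P ─ K ∣ ≤ δₑ G K
  δₑ-lower-bound {C} {P} {K} joined P⊆V C⊆K K⊆C∪P =
    subst (λ e → δₑ-neglecting G C P + e ≤ δₑ G K)
      (edgesBetween-joined (λ u∈C v∈P─K → joined u∈C (p─q⊆p P K v∈P─K)))
      (edgesBetween-disjoint C⊆K
        (λ x∈ → x∈p∧x∉q⇒x∈p─q (p─q⊆p (V G) (C ∪ P) x∈)
                               (x∈p─q⇒x∉q (V G) (C ∪ P) x∈ ∘ K⊆C∪P))
        (─-monoˡ-⊆ K P⊆V)
        (λ x∈ x∈P─K → x∈p─q⇒x∉q (V G) (C ∪ P) x∈ (q⊆p∪q C P (p─q⊆p P K x∈P─K))))

  -- Invariants along the search tree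

  module _ (R : Subset n → Subset n → Set)
           (descend : ∀ {C P v} → v ∈ P → R C P → R (C ∪ ⁅ v ⁆) (P ∩ N G v))
           (advance : ∀ {C P v} → R C P → R C (P ∖ v))
           {C′ P′ X′ : Subset n} {s : ProcMCE G C′ P′ X′} where

    -- Mutual induction on the path to the node `s`. The loop carries `S ⊆ P` because `descend`
    -- requires the chosen vertex of `S` to lie in the current `P`; each iteration removes the same
    -- vertex from both sets.
    node-invariant : ∀ {C P X} {t : ProcMCE G C P X} → s NodeOf t → R C P → R C′ P′
    loop-invariant : ∀ {C P X S} {l : Loop G C P X S} → s NodeOfLoop l → S ⊆ P → R C P → R C′ P′

    node-invariant root                      R₀ = R₀
    node-invariant (below {P′ = P} {vₚ = vₚ} s∈l) R₀ =
      loop-invariant s∈l (p─q⊆p P (N G vₚ)) R₀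

    loop-invariant (here {v∈S = v∈S} s∈t) S⊆P R₀ = node-invariant s∈t (descend (S⊆P v∈S) R₀)
    loop-invariant (there {v = v} s∈l)    S⊆P R₀ =
      loop-invariant s∈l (─-monoˡ-⊆ ⁅ v ⁆ S⊆P) (advance R₀)

  -- At the root C is empty. A recursive call on v adds v to C and cuts P down to neighbours of v,
  -- so v is joined to the new P; the other pairs are inherited.
  node-joined : (T : SearchTree G) → ∀ {C P X} {r : ProcMCE G C P X} → r NodeOf T →
    Joined C P × P ⊆ V G
  node-joined T r∈T = node-invariant (λ C P → Joined C P × P ⊆ V G)
    (λ {C} {P} {v} _ (joined , P⊆V) →
      (λ u∈C∪v w∈P∩N →
        let w∈P , w∈N = x∈p∩q⁻ P (N G v) w∈P∩N
        in [ (λ u∈C → joined u∈C w∈P)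
           , (λ u∈⁅v⁆ → subst (λ u → Adj u _) (sym (x∈⁅y⁆⇒x≡y v u∈⁅v⁆)) (∈N⇒Adj w∈N))
           ] (x∈p∪q⁻ C ⁅ v ⁆ u∈C∪v)) ,
      P⊆V ∘ p∩q⊆p P (N G v))
    (λ {C} {P} {v} (joined , P⊆V) →
      (λ u∈C w∈P → joined u∈C (p─q⊆p P ⁅ v ⁆ w∈P)) , P⊆V ∘ p─q⊆p P ⁅ v ⁆)
    r∈T ((λ u∈⊥ _ → contradiction u∈⊥ ∉⊥) , id)

  -- For `s` = `output K` the candidate set `C′` is K, which yields `C ⊆ K ⊆ C ∪ P`.
  node-bounds : ∀ {C P X C′ P′ X′} {t : ProcMCE G C P X} {s : ProcMCE G C′ P′ X′} → s NodeOf t →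
    C ⊆ C′ × C′ ⊆ C ∪ P
  node-bounds {C} {P} {t = t} s∈t =
    -- The third conjunct strengthens the induction: a vertex added to `C′` comes from `P′`, hence
    -- must be known to lie in `C ∪ P`.
    let C⊆C′ , C′⊆ , _ = node-invariant (λ C′ P′ → C ⊆ C′ × C′ ⊆ C ∪ P × P′ ⊆ C ∪ P)
          (λ {C′} {P′} {v} v∈P′ (C⊆C′ , C′⊆ , P′⊆) →
            p⊆p∪q ⁅ v ⁆ ∘ C⊆C′ ,
            (λ x∈ → [ C′⊆ , (λ x∈⁅v⁆ → subst (_∈ C ∪ P) (sym (x∈⁅y⁆⇒x≡y v x∈⁅v⁆)) (P′⊆ v∈P′)) ]
                      (x∈p∪q⁻ C′ ⁅ v ⁆ x∈)) ,
            P′⊆ ∘ p∩q⊆p P′ (N G v))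
          (λ {C′} {P′} {v} (C⊆C′ , C′⊆ , P′⊆) → C⊆C′ , C′⊆ , P′⊆ ∘ p─q⊆p P′ ⁅ v ⁆)
          s∈t (id , p⊆p∪q P , q⊆p∪q C P)
    in (λ x∈ → C⊆C′ x∈) , (λ x∈ → C′⊆ x∈)

-- Contradiction with isolation

-- The variables stand for δₑ(C, P), δₑ(K), |C|, |P|, |P ∖ K|, |D|, |K| and
-- ω(G[P]), in this order.
isolation-contradiction : ∀ {e f c p q d k w ℓ : ℕ} →
  w * (ℓ + c) + ℓ * c ≤ e + c * p → e + c * q ≤ f → p ≤ q + d → k ≤ c + d → d ≤ w →
  ¬ (f < ℓ * k)
isolation-contradiction {e} {f} {c} {p} {q} {d} {k} {w} {ℓ} cond e+cq≤f p≤q+d k≤c+d d≤w f<ℓk =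
  <-irrefl refl (begin-strict
    e + c * p             ≤⟨ +-monoʳ-≤ e (*-monoʳ-≤ c p≤q+d) ⟩
    e + c * (q + d)       ≡⟨ regroup e c q d ⟩
    (e + c * q) + c * d   ≤⟨ +-monoˡ-≤ (c * d) e+cq≤f ⟩
    f + c * d             <⟨ +-monoˡ-< (c * d) f<ℓk ⟩
    ℓ * k + c * d         ≤⟨ +-monoˡ-≤ (c * d) (*-monoʳ-≤ ℓ k≤c+d) ⟩
    ℓ * (c + d) + c * d   ≡⟨ collect ℓ c d ⟩
    d * (ℓ + c) + ℓ * c   ≤⟨ +-monoˡ-≤ (ℓ * c) (*-monoˡ-≤ (ℓ + c) d≤w) ⟩
    w * (ℓ + c) + ℓ * c   ≤⟨ cond ⟩
    e + c * p             ∎)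
  where
  open ≤-Reasoning

  regroup : ∀ e c q d → e + c * (q + d) ≡ (e + c * q) + c * d
  regroup = solve-∀

  collect : ∀ ℓ c d → ℓ * (c + d) + c * d ≡ d * (ℓ + c) + ℓ * c
  collect = solve-∀

theorem3 : ∀ {n} (G : Graph n) (ℓ : ℕ) .{{_ : NonZero ℓ}}
    (T : SearchTree G)
    {C P X : Subset n} (r : ProcMCE G C P X) → r NodeOf T →
    (ω̄ : ℚ) → fromℤ (+ ω (induced G P)) ℚ.≤ ω̄ →
    fromℤ (+ (δₑ-neglecting G C P + ∣ C ∣ * ∣ P ∣) - + (ℓ * ∣ C ∣))
    ℚ.≥ ω̄ ℚ.* fromℤ (+ (ℓ + ∣ C ∣)) →
    ¬ (∃ λ K → output K NodeOf r × IsMaximalClique G K × Isolated G ℓ K)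
theorem3 G ℓ T {C} {P} r r∈T ω̄ ω≤ω̄ cond (K , K∈r , (clique , _) , isolated)
  with joined , P⊆V ← node-joined G T r∈T | C⊆K , K⊆C∪P ← node-bounds G K∈r =
  isolation-contradiction
    (≤-eliminate-bound ω̄ ω≤ω̄ cond)
    (δₑ-lower-bound G joined P⊆V C⊆K K⊆C∪P)
    (∣p∣≤∣p─q∣+∣q∩p∣ P K)
    -- This is |K| ≤ |C| + |D| with D = `K ∩ P`.
    (≤-trans (p⊆q⇒∣p∣≤∣q∣ K⊆C∪D) (∣p∪q∣≤∣p∣+∣q∣ C (K ∩ P)))
    -- D inherits the clique property from K, now inside G[P], so |D| ≤ ω(G[P]).
    (clique⇒∣∣≤ω (induced G P) (induced-clique G P clique))
    isolated
  where
  K⊆C∪D : K ⊆ C ∪ (K ∩ P)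
  K⊆C∪D x∈K = [ p⊆p∪q (K ∩ P) , (λ x∈P → q⊆p∪q C (K ∩ P) (x∈p∩q⁺ (x∈K , x∈P))) ]
    (x∈p∪q⁻ C P (proj₂ (node-bounds G K∈r) x∈K))
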